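{- Let $\mathcal{G}$ be a finite DAG and let $f\colon V(\mathcal{G})\to\mathbb{R}$ be a non-monotone function. Then for some $k\ge1$ there exist Boolean functions $f_1,\dots,f_k\colon V(\mathcal{G})\to\{0,1\}$ and pairwise vertex-disjoint induced subgraphs $\mathcal{H}_1,\dots,\mathcal{H}_k$ of $\mathcal{G}$ such that: (1) $2\sum_{i=1}^k\varepsilon(f_i)\ge\varepsilon(f)$; (2) $\mathcal{S}^-_{f_i}\subseteq\mathcal{S}^-_f\cap E(\mathcal{H}_i)$ for all $i\in[k]$.
   Context: A DAG $\mathcal{G}$ induces a partial order on $V(\mathcal{G})$: $x\preceq y$ iff $\mathcal{G}$ contains a directed path from $x$ to $y$. A function $g\colon V(\mathcal{G})\to\mathbb{R}$ is monotone if $g(x)\le g(y)$ whenever $x\preceq y$. The distance to monotonicity $\varepsilon(g)$ is the minimum, over monotone $h\colon V(\mathcal{G})\to\mathbb{R}$, of the fraction of vertices $x$ with $g(x)\ne h(x)$. An edge $(x,y)\in E(\mathcal{G})$ is violated by $g$ if $g(x)>g(y)$; $\mathcal{S}^-_g$ is the set of edges of $\mathcal{G}$ violated by $g$.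
   Formalization: The function f, and the monotone functions h over which the distance to monotonicity is minimized, take rational values instead of real values. -}

module Defs where

open import Data.Nat using (ℕ; suc; _*_) renaming (_≤_ to _≤ℕ_)
open import Data.Fin using (Fin)
open import Data.Bool using (Bool; true; false)
open import Data.List using (List; length; filter; allFin; map)
open import Data.Nat.ListAction using (sum)
open import Data.List.Membership.Propositional using (_∈_)
open import Data.Product using (_×_; _,_; ∃)
open import Data.Rational using (ℚ; _≤_; _<_; 0ℚ; 1ℚ; _≟_)
open import Relation.Nullary using (¬_; ¬?)
open import Relation.Binary.PropositionalEquality using (_≡_; _≢_)
open import Relation.Binary.Construct.Closure.ReflexiveTransitive using (Star)
open import Relation.Binary.Construct.Closure.Transitive using (TransClosure)

record Graph (n : ℕ) : Set where
  field
    edges : List (Fin n × Fin n)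

Edge : ∀ {n} → Graph n → Fin n → Fin n → Set
Edge G x y = (x , y) ∈ Graph.edges G

IsDAG : ∀ {n} → Graph n → Set
IsDAG G = ∀ x → ¬ TransClosure (Edge G) x x

_⪯[_]_ : ∀ {n} → Fin n → Graph n → Fin n → Set
x ⪯[ G ] y = Star (Edge G) x y

Monotone : ∀ {n} → Graph n → (Fin n → ℚ) → Set
Monotone G g = ∀ x y → x ⪯[ G ] y → g x ≤ g y

diffCount : ∀ {n} → (Fin n → ℚ) → (Fin n → ℚ) → ℕ
diffCount {n} g h = length (filter (λ x → ¬? (g x ≟ h x)) (allFin n))

-- IsDist G g d : the minimum over monotone h of #{x | g x ≢ h x} equals d,
-- i.e. ε(g) = d / n.
IsDist : ∀ {n} → Graph n → (Fin n → ℚ) → ℕ → Set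
IsDist G g d =
  (∃ λ h → Monotone G h × diffCount g h ≡ d) ×
  (∀ h → Monotone G h → d ≤ℕ diffCount g h)

toℚ : Bool → ℚ
toℚ false = 0ℚ
toℚ true = 1ℚ

boolFun : ∀ {n} → (Fin n → Bool) → Fin n → ℚ
boolFun b x = toℚ (b x)

Violated : ∀ {n} → Graph n → (Fin n → ℚ) → Fin n → Fin n → Set
Violated G g x y = Edge G x y × g y < g x

InducedEdge : ∀ {n} → Graph n → (Fin n → Bool) → Fin n → Fin n → Set
InducedEdge G S x y = Edge G x y × S x ≡ true × S y ≡ true

sumFin : ∀ {k} → (Fin k → ℕ) → ℕ
sumFin {k} d = sum (map d (allFin k))

{-# OPTIONS --safe #-}

-- Replace f by its rank function r : V → ℕ and take a monotone h : V → ℕ at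
-- which Σ|r − h| cannot be lowered by adding or subtracting the indicator of a
-- vertex set while staying monotone.  The subgraphs are induced by the level
-- sets of h, and f_v is 1 above the level v, 0 below it, and on the level it is
-- either [r > v] throughout, or [r ≥ v] throughout.  Violated edges of f_v then
-- lie inside the level and are violated by f.
-- If g is monotone, then raising h by 1 on {h = v, g ≥ 1} keeps it monotone, and
-- optimality of h implies that g differs from the f_v using [r > v] in at least
-- #{h = v, r > v} vertices; hence, counting ε in vertices, Σ ε(f_v) ≥ #{r > h}.  Symmetrically,
-- lowering h gives Σ ε(f_v) ≥ #{r < h} for the other choice of the f_v.
-- As h yields a monotone function differing from f only where r ≠ h, one of the
-- two choices satisfies 2 Σ ε(f_v) ≥ ε(f).

module Submission where

open import Defs
open import Data.Nat using (ℕ; suc; _*_; _≤_)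
open import Data.Fin using (Fin)
open import Data.Bool using (Bool; true)
open import Data.Rational using (ℚ)
open import Data.Product using (Σ; ∃; _×_)
open import Relation.Nullary using (¬_)
open import Relation.Binary.PropositionalEquality using (_≡_; _≢_)

open import Data.Nat using (zero; _+_; _∸_; _<_; z≤n; s≤s; ∣_-_∣; _≟_; _<?_; _≤?_)
open import Data.Nat.Properties
open import Algebra.Properties.CommutativeSemigroup +-commutativeSemigroup using (interchange)
open import Data.Nat.Induction using (<-wellFounded)
open import Data.Nat.ListAction using (sum)
open import Induction.WellFounded using (Acc; acc)
open import Data.Fin using (toℕ; fromℕ<)
open import Data.Fin.Properties using (toℕ-fromℕ<; toℕ-injective)
open import Data.Fin.Subset using (Subset)
open import Data.Fin.Subset.Properties using (anySubset?)
open import Data.Bool using (false; _∨_)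
open import Data.Vec using (lookup; tabulate)
open import Data.Vec.Properties using (lookup∘tabulate)
import Data.Rational as ℚ
import Data.Rational.Properties as ℚ
open import Data.List using (List; []; _∷_; length; filter; map; allFin)
open import Data.List.Properties using (map-cong)
open import Relation.Binary using (DecTotalOrder; tri<; tri≈; tri>)
open import Data.List.Extrema (DecTotalOrder.totalOrder ℚ.≤-decTotalOrder)
  using (max; min; max≈v⁺; max-mono-⊆; min≤xs)
open import Data.List.Membership.Propositional using (_∈_)
open import Data.List.Membership.Propositional.Properties
  using (∈-allFin; ∈-map⁺; ∈-map⁻; ∈-filter⁺; ∈-filter⁻)
open import Data.List.Relation.Binary.Subset.Propositional.Properties
  using (map⁺; filter⁺′)
open import Data.List.Relation.Unary.All as All using (All; all?)
open import Data.List.Relation.Unary.Any using (here; there)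
open import Data.Product using (_,_; proj₁; proj₂)
open import Data.Sum using (_⊎_; inj₁; inj₂)
open import Function using (_∘_; id)
open import Relation.Nullary using (Dec; yes; no; does; ¬?; contradiction; _×-dec_; _⊎-dec_)
open import Relation.Nullary.Decidable using (from-yes; from-no; dec-true; dec-false)
open import Relation.Unary using (Pred; Decidable)
open import Relation.Binary.Construct.Closure.ReflexiveTransitive using (ε; _◅_)
open import Relation.Binary.PropositionalEquality using (refl; sym; trans; cong; subst; subst₂)

-- Indicators and double counting in finite sums.

indicator : Bool → ℕ
indicator false = 0
indicator true  = 1

indicator≤1 : ∀ b → indicator b ≤ 1
indicator≤1 false = z≤n
indicator≤1 true  = ≤-refl

-- The Iverson bracket. It looks only at `does`, so brackets of `×-dec` and `⊎-dec` compute once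
-- their parts are matched on.
[_] : ∀ {P : Set} → Dec P → ℕ
[ P? ] = indicator (does P?)

[]-mono : ∀ {P Q : Set} (P? : Dec P) (Q? : Dec Q) → (P → Q) → [ P? ] ≤ [ Q? ]
[]-mono (no _)  _       _   = z≤n
[]-mono (yes p) (yes _) _   = ≤-refl
[]-mono (yes p) (no ¬q) p⇒q = contradiction (p⇒q p) ¬q

module _ {A : Set} where

  sum-map-mono : ∀ {a b : A → ℕ} → (∀ x → a x ≤ b x) → ∀ xs → sum (map a xs) ≤ sum (map b xs)
  sum-map-mono a≤b []       = z≤n
  sum-map-mono a≤b (x ∷ xs) = +-mono-≤ (a≤b x) (sum-map-mono a≤b xs)

  sum-map-mono-< : ∀ {a b : A → ℕ} → (∀ x → a x ≤ b x) →
                   ∀ {z xs} → z ∈ xs → a z < b z → sum (map a xs) < sum (map b xs)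
  sum-map-mono-< a≤b (here {xs = xs} refl) az<bz = +-mono-<-≤ az<bz (sum-map-mono a≤b xs)
  sum-map-mono-< a≤b (there {x = x} z∈xs)  az<bz = +-mono-≤-< (a≤b x) (sum-map-mono-< a≤b z∈xs az<bz)

  sum-map-+ : ∀ (a b : A → ℕ) xs → sum (map (λ x → a x + b x) xs) ≡ sum (map a xs) + sum (map b xs)
  sum-map-+ a b []       = refl
  sum-map-+ a b (x ∷ xs) =
    trans (cong (a x + b x +_) (sum-map-+ a b xs)) (interchange (a x) (b x) _ _)

  ≤sum-map : ∀ (a : A → ℕ) {z xs} → z ∈ xs → a z ≤ sum (map a xs)
  ≤sum-map a (here refl)  = m≤m+n _ _
  ≤sum-map a (there z∈xs) = ≤-trans (≤sum-map a z∈xs) (m≤n+m _ _)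

  length-filter-sum : ∀ {P : Pred A _} (P? : Decidable P) xs →
                      length (filter P? xs) ≡ sum (map (λ x → [ P? x ]) xs)
  length-filter-sum P? [] = refl
  length-filter-sum P? (x ∷ xs) with P? x
  ... | yes _ = cong suc (length-filter-sum P? xs)
  ... | no _  = length-filter-sum P? xs

sum-map-zero : ∀ {A : Set} (xs : List A) → sum (map (λ _ → 0) xs) ≡ 0
sum-map-zero []       = refl
sum-map-zero (_ ∷ xs) = sum-map-zero xs

sum-map-swap : ∀ {A B : Set} (a : A → B → ℕ) xs ys →
               sum (map (λ x → sum (map (a x) ys)) xs) ≡ sum (map (λ y → sum (map (λ x → a x y) xs)) ys)
sum-map-swap a []       ys = sym (sum-map-zero ys)
sum-map-swap a (x ∷ xs) ys =
  trans (cong (sum (map (a x) ys) +_) (sum-map-swap a xs ys)) (sym (sum-map-+ (a x) _ ys))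

sumFin-mono : ∀ {k} {a b : Fin k → ℕ} → (∀ i → a i ≤ b i) → sumFin a ≤ sumFin b
sumFin-mono a≤b = sum-map-mono a≤b (allFin _)

sumFin-+ : ∀ {k} (a b : Fin k → ℕ) → sumFin (λ i → a i + b i) ≡ sumFin a + sumFin b
sumFin-+ a b = sum-map-+ a b (allFin _)

-- Directions, and predicates on the values at one vertex.

-- The direction in which h is moved: up goes with f_v = [r > v], down with [r ≥ v].
data Direction : Set where
  up down : Direction

shift : Direction → ℕ → ℕ → ℕ
shift up   = _+_
shift down = _∸_

Above : Direction → ℕ → ℕ → Set
Above up   v r = v < r
Above down v r = v ≤ r

above? : ∀ δ v r → Dec (Above δ v r)
above? up   = _<?_
above? down = _≤?_

Excess : Direction → ℕ → ℕ → Set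
Excess up   r v = v < r
Excess down r v = r < v

excess? : ∀ δ r v → Dec (Excess δ r v)
excess? up   r v = v <? r
excess? down r v = r <? v

-- One threshold serves both directions: `1 ≤ q` excludes `q = 0`, and `q < 1` excludes `q = 1`.
-- This is how `excess-payment` detects that `g` disagrees with a Boolean value.
Moves : Direction → ℚ → Set
Moves up   q = ℚ.1ℚ ℚ.≤ q
Moves down q = q ℚ.< ℚ.1ℚ

moves? : ∀ δ q → Dec (Moves δ q)
moves? up   q = ℚ.1ℚ ℚ.≤? q
moves? down q = q ℚ.<? ℚ.1ℚ

One : Direction → ℕ → ℕ → ℕ → Set
One δ v h r = v < h ⊎ (h ≡ v × Above δ v r)

one? : ∀ δ v h r → Dec (One δ v h r)
one? δ v h r = (v <? h) ⊎-dec ((h ≟ v) ×-dec above? δ v r)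

movesAt? : ∀ δ v h q → Dec (h ≡ v × Moves δ q)
movesAt? δ v h q = (h ≟ v) ×-dec moves? δ q

excessAt? : ∀ δ v h r → Dec (h ≡ v × Excess δ r v)
excessAt? δ v h r = (h ≟ v) ×-dec excess? δ r v

differ? : ∀ p q → Dec (p ≢ q)
differ? p q = ¬? (p ℚ.≟ q)

-- Inequalities at a single vertex or edge.

above-separates : ∀ δ {v r s} → Above δ v r → ¬ Above δ v s → s < r
above-separates up   v<r v≮s = ≤-<-trans (≮⇒≥ v≮s) v<r
above-separates down v≤r v≰s = <-≤-trans (≰⇒> v≰s) v≤r

shift-zero : ∀ δ h → shift δ h 0 ≡ h
shift-zero up   h = +-identityʳ h
shift-zero down h = refl

-- If both ends lie on the level, the threshold on `q` makes the moved set closed upwards for `up`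
-- and downwards for `down`. If only one end does, the values of `h` differ by at least 1, which
-- absorbs the unit shift.
shift-indicator-mono : ∀ δ {v h h′ q q′} (at : Dec (h ≡ v)) (at′ : Dec (h′ ≡ v))
  (moves : Dec (Moves δ q)) (moves′ : Dec (Moves δ q′)) → h ≤ h′ → q ℚ.≤ q′ →
  shift δ h [ at ×-dec moves ] ≤ shift δ h′ [ at′ ×-dec moves′ ]
shift-indicator-mono up (yes refl) (yes refl) m m′ h≤h′ q≤q′ =
  +-monoʳ-≤ _ ([]-mono m m′ (λ 1≤q → ℚ.≤-trans 1≤q q≤q′))
shift-indicator-mono up {v} {_} {h′} (yes refl) (no h′≢v) m m′ h≤h′ q≤q′ = begin
  v + [ m ] ≤⟨ +-monoʳ-≤ v (indicator≤1 (does m)) ⟩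
  v + 1     ≡⟨ +-comm v 1 ⟩
  suc v     ≤⟨ ≤∧≢⇒< h≤h′ (h′≢v ∘ sym) ⟩
  h′        ≤⟨ m≤m+n h′ 0 ⟩
  h′ + 0    ∎
  where open ≤-Reasoning
shift-indicator-mono up {h = h} (no _) _ m m′ h≤h′ q≤q′ =
  ≤-trans (≤-reflexive (+-identityʳ h)) (≤-trans h≤h′ (m≤m+n _ _))
shift-indicator-mono down {v} (yes refl) (yes refl) m m′ h≤h′ q≤q′ =
  ∸-monoʳ-≤ v ([]-mono m′ m (λ q′<1 → ℚ.≤-<-trans q≤q′ q′<1))
shift-indicator-mono down {v} {h} (no h≢v) (yes refl) m m′ h≤h′ q≤q′ = begin
  h          ≤⟨ ∸-monoˡ-≤ 1 (≤∧≢⇒< h≤h′ h≢v) ⟩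
  v ∸ 1      ≤⟨ ∸-monoʳ-≤ v (indicator≤1 (does m′)) ⟩
  v ∸ [ m′ ] ∎
  where open ≤-Reasoning
shift-indicator-mono down {h = h} (yes refl) (no _) m m′ h≤h′ q≤q′ = ≤-trans (m∸n≤m h [ m ]) h≤h′
shift-indicator-mono down (no _) (no _) m m′ h≤h′ q≤q′ = h≤h′

-- The bars parse as a distance from `r` to the shifted value `v + 1`; likewise for `v ∸ 1` below.
closer-up : ∀ {v r} → v < r → suc ∣ r - v + 1 ∣ ≡ ∣ r - v ∣
closer-up {zero}  {suc r} _         = cong suc (∣-∣-identityʳ r)
closer-up {suc v} {suc r} (s≤s v<r) = closer-up v<r

closer-down : ∀ {v r} → r < v → suc ∣ r - v ∸ 1 ∣ ≡ ∣ r - v ∣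
closer-down {suc v} {zero}  _         = refl
closer-down {suc (suc v)} {suc r} (s≤s r<v) = closer-down r<v

farther-up : ∀ r v → ∣ r - v + 1 ∣ ≤ ∣ r - v ∣ + 1
farther-up r v = ≤-trans (∣-∣-triangle r v (v + 1)) (+-monoʳ-≤ ∣ r - v ∣ (≤-reflexive (∣m-m+n∣≡n v 1)))

farther-down : ∀ r v → ∣ r - v ∸ 1 ∣ ≤ ∣ r - v ∣ + 1
-- Truncated subtraction leaves the value 0 in place, so the distance is unchanged.
farther-down r zero    = m≤m+n _ 1
farther-down r (suc v) = ≤-trans (∣-∣-triangle r (suc v) v) (+-monoʳ-≤ ∣ r - suc v ∣ (≤-reflexive step))
  where
  step : ∣ suc v - v ∣ ≡ 1
  step = trans (∣-∣-comm (suc v) v) (trans (cong ∣ v -_∣ (+-comm 1 v)) (∣m-m+n∣≡n v 1))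

-- Each excess vertex of the level either moves, which lowers its distance to
-- the rank, or is one where g differs from the Boolean function.
excess-payment : ∀ δ {v h r q} (at : Dec (h ≡ v)) (over : Dec (v < h))
  (excess : Dec (Excess δ r v)) (moves : Dec (Moves δ q)) (above : Dec (Above δ v r))
  (differ : Dec (toℚ (does (over ⊎-dec (at ×-dec above))) ≢ q)) →
  [ at ×-dec excess ] + ∣ r - shift δ h [ at ×-dec moves ] ∣ ≤ ∣ r - h ∣ + [ differ ]
excess-payment δ {h = h} (no _) _ _ _ _ _ rewrite shift-zero δ h = m≤m+n _ _
excess-payment δ (yes refl) (yes v<v) _ _ _ _ = contradiction v<v (<-irrefl refl)
excess-payment up (yes refl) (no _) (yes v<r) _ (no v≮r) _ = contradiction v<r v≮r
excess-payment up (yes refl) (no _) (no v≮r) _ (yes v<r) _ = contradiction v<r v≮r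
excess-payment up (yes refl) (no _) (yes v<r) (yes _) (yes _) _ =
  ≤-trans (≤-reflexive (closer-up v<r)) (m≤m+n _ _)
excess-payment up {v} (yes refl) (no _) (no _) (no _) (no _) _ rewrite +-identityʳ v = m≤m+n _ _
excess-payment up {v} (yes refl) (no _) (yes _) (no _) (yes _) (yes _)
  rewrite +-identityʳ v = ≤-reflexive (+-comm 1 _)
excess-payment up (yes refl) (no _) (yes _) (no 1≰q) (yes _) (no same) =
  contradiction (λ { refl → 1≰q ℚ.≤-refl }) same
-- A vertex moved without excess may recede from its rank by 1. The Boolean value is 0 there while
-- `1 ≤ q`, so the disagreement pays for it.
excess-payment up {v} {_} {r} (yes refl) (no _) (no _) (yes _) (no _) (yes _) = farther-up r v
excess-payment up (yes refl) (no _) (no _) (yes 1≤q) (no _) (no same) =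
  contradiction (λ { refl → from-no (ℚ.1ℚ ℚ.≤? ℚ.0ℚ) 1≤q }) same
-- For `down`, excess vertices are those not above, so their Boolean value is 0 and the roles of 0
-- and 1 are exchanged.
excess-payment down (yes refl) (no _) (yes r<v) _ (yes v≤r) _ = contradiction v≤r (<⇒≱ r<v)
excess-payment down (yes refl) (no _) (no r≮v) _ (no v≰r) _ = contradiction (≰⇒> v≰r) r≮v
excess-payment down (yes refl) (no _) (yes r<v) (yes _) (no _) _ =
  ≤-trans (≤-reflexive (closer-down r<v)) (m≤m+n _ _)
excess-payment down (yes refl) (no _) (no _) (no _) (yes _) _ = m≤m+n _ _
excess-payment down (yes refl) (no _) (yes _) (no _) (no _) (yes _) = ≤-reflexive (+-comm 1 _)
excess-payment down (yes refl) (no _) (yes _) (no q≮1) (no _) (no same) =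
  contradiction (λ { refl → q≮1 (from-yes (ℚ.0ℚ ℚ.<? ℚ.1ℚ)) }) same
excess-payment down {v} {_} {r} (yes refl) (no _) (no _) (yes _) (yes _) (yes _) = farther-down r v
excess-payment down (yes refl) (no _) (no _) (yes q<1) (yes _) (no same) =
  contradiction (λ { refl → ℚ.<-irrefl refl q<1 }) same

-- Locally optimal monotone functions.

module _ {n} (G : Graph n) where

  -- Stated on edges, so that the edge list decides it; `monotone-∘` passes to paths.
  EdgeMonotone : (Fin n → ℕ) → Set
  EdgeMonotone h = All (λ e → h (proj₁ e) ≤ h (proj₂ e)) (Graph.edges G)

  edgeMonotone? : ∀ h → Dec (EdgeMonotone h)
  edgeMonotone? h = all? (λ e → h (proj₁ e) ≤? h (proj₂ e)) (Graph.edges G)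

  monotone-∘ : ∀ {φ : ℕ → ℚ} {h} → (∀ {a b} → a ≤ b → φ a ℚ.≤ φ b) → EdgeMonotone h → Monotone G (φ ∘ h)
  monotone-∘ φ-mono h-mono x .x ε        = ℚ.≤-refl
  monotone-∘ φ-mono h-mono x z  (e ◅ es) =
    ℚ.≤-trans (φ-mono (All.lookup h-mono e)) (monotone-∘ φ-mono h-mono _ z es)

  move : Direction → (Fin n → Bool) → (Fin n → ℕ) → Fin n → ℕ
  move δ u h x = shift δ (h x) (indicator (u x))

  cost : (Fin n → ℕ) → (Fin n → ℕ) → ℕ
  cost r h = sumFin (λ x → ∣ r x - h x ∣)

  LocallyOptimal : (Fin n → ℕ) → (Fin n → ℕ) → Set
  LocallyOptimal r h = ∀ δ u → EdgeMonotone (move δ u h) → cost r h ≤ cost r (move δ u h)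

  -- Vertex sets are vectors here, so that `anySubset?` can search them exhaustively;
  -- `¬improvable⇒optimal` returns to Boolean functions by pointwise equality.
  Improves : (Fin n → ℕ) → Direction → (Fin n → ℕ) → Subset n → Set
  Improves r δ h s = EdgeMonotone (move δ (lookup s) h) × cost r (move δ (lookup s) h) < cost r h

  improvable? : ∀ r δ h → Dec (∃ (Improves r δ h))
  improvable? r δ h = anySubset? (λ s → edgeMonotone? _ ×-dec _ <? _)

  ¬improvable⇒optimal : ∀ r h → (∀ δ → ¬ ∃ (Improves r δ h)) → LocallyOptimal r h
  ¬improvable⇒optimal r h ¬imp δ u mono = ≮⇒≥ λ lower →
    ¬imp δ (tabulate u
      , All.map (λ {e} → subst₂ _≤_ (sym (same (proj₁ e))) (sym (same (proj₂ e)))) mono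
      , subst (_< cost r h) (cong sum (map-cong (λ x → cong ∣ r x -_∣ (sym (same x))) (allFin n))) lower)
    where
    same : ∀ x → move δ (lookup (tabulate u)) h x ≡ move δ u h x
    same x = cong (shift δ (h x) ∘ indicator) (lookup∘tabulate u x)

  -- Each improvement strictly lowers the natural number `cost r h`, so the search ends.
  descend : ∀ r h → EdgeMonotone h → Acc _<_ (cost r h) → ∃ λ h′ → EdgeMonotone h′ × LocallyOptimal r h′
  descend r h mono (acc rec) with improvable? r up h | improvable? r down h
  ... | yes (_ , mono′ , lower) | _                       = descend r _ mono′ (rec lower)
  ... | no _                    | yes (_ , mono′ , lower) = descend r _ mono′ (rec lower)
  ... | no ¬up                  | no ¬down                =
    h , mono , ¬improvable⇒optimal r h λ { up → ¬up ; down → ¬down }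

  optimal-exists : ∀ r → ∃ λ h → EdgeMonotone h × LocallyOptimal r h
  optimal-exists r = descend r (λ _ → 0) (All.tabulate (λ _ → z≤n)) (<-wellFounded _)

  levelFun : Direction → (r h : Fin n → ℕ) → ℕ → Fin n → Bool
  levelFun δ r h v x = does (one? δ v (h x) (r x))

  -- Sum `excess-payment` over all vertices, with `u` the part of the level that `g` selects. By
  -- optimality this move does not lower the cost, so after cancelling `cost r h` the disagreements
  -- with `g` must cover the excess.
  excess≤diffCount : ∀ {r h} → EdgeMonotone h → LocallyOptimal r h →
    ∀ δ v {g} → Monotone G g →
    sumFin (λ x → [ excessAt? δ v (h x) (r x) ]) ≤ diffCount (boolFun (levelFun δ r h v)) g
  excess≤diffCount {r} {h} h-mono opt δ v {g} g-mono = +-cancelʳ-≤ (cost r h) _ _ (begin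
    sumFin excess + cost r h
      ≤⟨ +-monoʳ-≤ (sumFin excess) (opt δ u (All.tabulate h′-mono)) ⟩
    sumFin excess + cost r (move δ u h)
      ≡⟨ sumFin-+ excess _ ⟨
    sumFin (λ x → excess x + ∣ r x - move δ u h x ∣)
      ≤⟨ sumFin-mono (λ x → excess-payment δ (h x ≟ v) (v <? h x) (excess? δ (r x) v)
                                     (moves? δ (g x)) (above? δ v (r x)) (differ? _ (g x))) ⟩
    sumFin (λ x → ∣ r x - h x ∣ + [ differ? (boolFun (levelFun δ r h v) x) (g x) ])
      ≡⟨ sumFin-+ (λ x → ∣ r x - h x ∣) _ ⟩
    cost r h + sumFin (λ x → [ differ? (boolFun (levelFun δ r h v) x) (g x) ])
      ≡⟨ cong (cost r h +_) (length-filter-sum (λ x → differ? (boolFun (levelFun δ r h v) x) (g x)) (allFin n)) ⟨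
    cost r h + diffCount (boolFun (levelFun δ r h v)) g
      ≡⟨ +-comm (cost r h) _ ⟩
    diffCount (boolFun (levelFun δ r h v)) g + cost r h ∎)
    where
    open ≤-Reasoning
    excess : Fin n → ℕ
    excess x = [ excessAt? δ v (h x) (r x) ]
    u : Fin n → Bool
    u x = does (movesAt? δ v (h x) (g x))
    h′-mono : ∀ {e} → e ∈ Graph.edges G → move δ u h (proj₁ e) ≤ move δ u h (proj₂ e)
    h′-mono e = shift-indicator-mono δ (_ ≟ v) (_ ≟ v) (moves? δ _) (moves? δ _)
                                     (All.lookup h-mono e) (g-mono _ _ (e ◅ ε))

-- Ranks and the way back to rational values.

module _ {n} (f : Fin n → ℚ) where

  -- Natural values make unit moves meaningful and the cost well-founded, while the order of the
  -- values of `f` is retained.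
  rank : Fin n → ℕ
  rank x = sumFin (λ y → [ f y ℚ.<? f x ])

  rank-cancel-< : ∀ {x y} → rank x < rank y → f x ℚ.< f y
  rank-cancel-< {x} {y} rx<ry = ℚ.≰⇒> λ fy≤fx → <⇒≱ rx<ry
    (sumFin-mono (λ z → []-mono (f z ℚ.<? f y) (f z ℚ.<? f x) (λ fz<fy → ℚ.<-≤-trans fz<fy fy≤fx)))

  -- If `f y < f x`, then `y` is counted in the rank of `x` but not in its own, so its rank is
  -- strictly smaller.
  rank-cancel-≤ : ∀ {x y} → rank x ≤ rank y → f x ℚ.≤ f y
  rank-cancel-≤ {x} {y} rx≤ry = ℚ.≮⇒≥ λ fy<fx → <⇒≱
    (sum-map-mono-< (λ z → []-mono (f z ℚ.<? f y) (f z ℚ.<? f x) (λ fz<fy → ℚ.<-trans fz<fy fy<fx))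
                    (∈-allFin y) (strict fy<fx)) rx≤ry
    where
    strict : f y ℚ.< f x → [ f y ℚ.<? f y ] < [ f y ℚ.<? f x ]
    strict fy<fx = subst₂ (λ a b → indicator a < indicator b)
      (sym (dec-false (f y ℚ.<? f y) (ℚ.<-irrefl refl))) (sym (dec-true (f y ℚ.<? f x) fy<fx)) ≤-refl

  rank≤ : ℕ → List (Fin n)
  rank≤ v = filter (λ y → rank y ≤? v) (allFin n)

  -- A monotone inverse of the rank is needed on all of ℕ, as `h` may take values that are no rank;
  -- there the largest value of `f` at smaller ranks is kept.
  unrank : ℕ → ℚ
  -- The default is at most every value of `f`, so it does not disturb the maximum at an actual
  -- rank.
  unrank v = max (min ℚ.0ℚ (map f (allFin n))) (map f (rank≤ v))

  unrank-mono : ∀ {v w} → v ≤ w → unrank v ℚ.≤ unrank w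
  unrank-mono {v} {w} v≤w = max-mono-⊆ {xs = map f (rank≤ v)} {ys = map f (rank≤ w)} ℚ.≤-refl
    (map⁺ f (filter⁺′ (λ y → rank y ≤? v) (λ y → rank y ≤? w) (λ ry≤v → ≤-trans ry≤v v≤w) {allFin n} id))

  unrank-rank : ∀ x → unrank (rank x) ≡ f x
  unrank-rank x = max≈v⁺
    (∈-map⁺ f (∈-filter⁺ (λ y → rank y ≤? rank x) (∈-allFin x) ≤-refl))
    (All.tabulate below)
    (All.lookup (min≤xs ℚ.0ℚ (map f (allFin n))) (∈-map⁺ f (∈-allFin x)))
    where
    below : ∀ {q} → q ∈ map f (rank≤ (rank x)) → q ℚ.≤ f x
    below q∈ with ∈-map⁻ f q∈
    ... | y , y∈ , refl = rank-cancel-≤ (proj₂ (∈-filter⁻ (λ y → rank y ≤? rank x) {xs = allFin n} y∈))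

  totalExcess : Direction → (Fin n → ℕ) → ℕ
  totalExcess δ h = sumFin (λ x → [ excess? δ (rank x) (h x) ])

  diffCount≤excess : ∀ h → diffCount f (unrank ∘ h) ≤ totalExcess up h + totalExcess down h
  diffCount≤excess h = begin
    diffCount f (unrank ∘ h)
      ≡⟨ length-filter-sum (λ x → differ? (f x) (unrank (h x))) (allFin n) ⟩
    sumFin (λ x → [ differ? (f x) (unrank (h x)) ])
      ≤⟨ sumFin-mono pointwise ⟩
    sumFin (λ x → [ excess? up (rank x) (h x) ] + [ excess? down (rank x) (h x) ])
      ≡⟨ sumFin-+ (λ x → [ excess? up (rank x) (h x) ]) _ ⟩
    totalExcess up h + totalExcess down h ∎
    where
    open ≤-Reasoning
    pointwise : ∀ x → [ differ? (f x) (unrank (h x)) ] ≤ [ h x <? rank x ] + [ rank x <? h x ]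
    pointwise x = ≤-trans
      ([]-mono (differ? (f x) (unrank (h x))) ((h x <? rank x) ⊎-dec (rank x <? h x)) split)
      (∨≤+ (does (h x <? rank x)) _)
      where
      split : f x ≢ unrank (h x) → h x < rank x ⊎ rank x < h x
      split f≢ with <-cmp (h x) (rank x)
      ... | tri< h<r _ _ = inj₁ h<r
      ... | tri≈ _ h≡r _ = contradiction (trans (sym (unrank-rank x)) (cong unrank (sym h≡r))) f≢
      ... | tri> _ _ r<h = inj₂ r<h
      ∨≤+ : ∀ a b → indicator (a ∨ b) ≤ indicator a + indicator b
      ∨≤+ false b = ≤-refl
      ∨≤+ true  b = m≤m+n 1 _

  -- Each vertex is counted at its own level `h x`, an index because of the bound `k`; exchanging
  -- the sums groups vertices by level.
  totalExcess≤levels : ∀ δ h {k} → (∀ x → h x < k) →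
    totalExcess δ h ≤ sumFin {k} (λ i → sumFin (λ x → [ excessAt? δ (toℕ i) (h x) (rank x) ]))
  totalExcess≤levels δ h {k} h<k = begin
    totalExcess δ h
      ≤⟨ sumFin-mono (λ x → ≤-trans (own x) (≤sum-map (at x) (∈-allFin (fromℕ< (h<k x))))) ⟩
    sumFin (λ x → sumFin (at x))
      ≡⟨ sum-map-swap at (allFin n) (allFin k) ⟩
    sumFin {k} (λ i → sumFin (λ x → at x i)) ∎
    where
    open ≤-Reasoning
    at : Fin n → Fin k → ℕ
    at x i = [ excessAt? δ (toℕ i) (h x) (rank x) ]
    own : ∀ x → [ excess? δ (rank x) (h x) ] ≤ at x (fromℕ< (h<k x))
    own x rewrite toℕ-fromℕ< (h<k x) =
      []-mono (excess? δ (rank x) (h x)) (excessAt? δ (h x) (h x) (rank x)) (refl ,_)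

  larger-excess : ∀ h → ∃ λ δ → totalExcess up h + totalExcess down h ≤ 2 * totalExcess δ h
  larger-excess h with ≤-total (totalExcess up h) (totalExcess down h)
  ... | inj₁ u≤d = down , +-mono-≤ u≤d (m≤m+n _ 0)
  ... | inj₂ d≤u = up , +-monoʳ-≤ _ (≤-trans d≤u (m≤m+n _ 0))

-- Violated edges and the conclusion.

toℚ-< : ∀ a b → toℚ a ℚ.< toℚ b → a ≡ false × b ≡ true
toℚ-< false true  _   = refl , refl
toℚ-< false false 0<0 = contradiction 0<0 (ℚ.<-irrefl refl)
toℚ-< true  true  1<1 = contradiction 1<1 (ℚ.<-irrefl refl)
toℚ-< true  false 1<0 = contradiction 1<0 (from-no (ℚ.1ℚ ℚ.<? ℚ.0ℚ))

-- Along an edge `h` does not decrease. A tail above the level would force the head above it, where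
-- the value is also 1; so the tail is on the level, and a head with value 0 cannot lie higher. On
-- the level only `Above` separates the ends.
violated-in-level : ∀ δ v {a b r s} → a ≤ b → One δ v a r → ¬ One δ v b s → a ≡ v × b ≡ v × s < r
violated-in-level δ v a≤b (inj₁ v<a) ¬one = contradiction (inj₁ (<-≤-trans v<a a≤b)) ¬one
violated-in-level δ v a≤b (inj₂ (refl , above)) ¬one =
  refl , v≡b , above-separates δ above (λ above′ → ¬one (inj₂ (v≡b , above′)))
  where v≡b = ≤-antisym (≮⇒≥ (¬one ∘ inj₁)) a≤b

true⇒ : ∀ {P : Set} (P? : Dec P) → does P? ≡ true → P
true⇒ (yes p) _ = p

false⇒ : ∀ {P : Set} (P? : Dec P) → does P? ≡ false → ¬ P
false⇒ (no ¬p) _ = ¬p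

theorem1p3 : ∀ {n} (G : Graph n) → IsDAG G → (f : Fin n → ℚ) → ¬ Monotone G f →
    Σ ℕ λ k' → Σ (Fin (suc k') → Fin n → Bool) λ fs → Σ (Fin (suc k') → Fin n → Bool) λ S →
    (∀ i j → i ≢ j → ∀ x → ¬ (S i x ≡ true × S j x ≡ true)) ×
    (∀ (d : ℕ) (ds : Fin (suc k') → ℕ) → IsDist G f d → (∀ i → IsDist G (boolFun (fs i)) (ds i)) →
    d ≤ 2 * sumFin ds) ×
    (∀ i x y → Violated G (boolFun (fs i)) x y → Violated G f x y × InducedEdge G (S i) x y)
theorem1p3 {n} G _ f _ with optimal-exists G (rank f)
... | h , h-mono , opt with larger-excess f h
-- The sum of `h` bounds each of its values, so the indices from 0 to `sumFin h` include every
-- level.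
... | δ , excess≤2δ = sumFin h , fs , level , disjoint , distance , violations
  where
  fs level : Fin (suc (sumFin h)) → Fin n → Bool
  fs i      = levelFun G δ (rank f) h (toℕ i)
  level i x = does (h x ≟ toℕ i)

  disjoint : ∀ i j → i ≢ j → ∀ x → ¬ (level i x ≡ true × level j x ≡ true)
  disjoint i j i≢j x (x∈i , x∈j) =
    i≢j (toℕ-injective (trans (sym (true⇒ (h x ≟ toℕ i) x∈i)) (true⇒ (h x ≟ toℕ j) x∈j)))

  distance : ∀ d ds → IsDist G f d → (∀ i → IsDist G (boolFun (fs i)) (ds i)) → d ≤ 2 * sumFin ds
  distance d ds (_ , d≤) dists = begin
    d
      ≤⟨ d≤ (unrank f ∘ h) (monotone-∘ G (unrank-mono f) h-mono) ⟩
    diffCount f (unrank f ∘ h)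
      ≤⟨ diffCount≤excess f h ⟩
    totalExcess f up h + totalExcess f down h
      ≤⟨ excess≤2δ ⟩
    2 * totalExcess f δ h
      ≤⟨ *-monoʳ-≤ 2 (totalExcess≤levels f δ h (λ x → s≤s (≤sum-map h (∈-allFin x)))) ⟩
    2 * sumFin {suc (sumFin h)} (λ i → sumFin (λ x → [ excessAt? δ (toℕ i) (h x) (rank f x) ]))
      ≤⟨ *-monoʳ-≤ 2 (sumFin-mono level≤) ⟩
    2 * sumFin ds ∎
    where
    open ≤-Reasoning
    level≤ : ∀ i → sumFin (λ x → [ excessAt? δ (toℕ i) (h x) (rank f x) ]) ≤ ds i
    -- The bound holds for every monotone `g`, hence for one that attains `ds i`.
    level≤ i with dists i
    ... | (g , g-mono , diff≡) , _ = ≤-trans (excess≤diffCount G h-mono opt δ (toℕ i) g-mono) (≤-reflexive diff≡)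

  violations : ∀ i x y → Violated G (boolFun (fs i)) x y → Violated G f x y × InducedEdge G (level i) x y
  violations i x y (e , lt) with toℚ-< (fs i y) (fs i x) lt
  ... | y-zero , x-one
    with violated-in-level δ (toℕ i) (All.lookup h-mono e)
           (true⇒ (one? δ (toℕ i) (h x) (rank f x)) x-one)
           (false⇒ (one? δ (toℕ i) (h y) (rank f y)) y-zero)
  ... | hx≡i , hy≡i , ry<rx =
    (e , rank-cancel-< f ry<rx) , e , dec-true (h x ≟ toℕ i) hx≡i , dec-true (h y ≟ toℕ i) hy≡i
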